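{- For all integers $n\geq 1$ and $k\geq 1$, $$B_k^e(n)=C_k^e(n+1)\qquad\text{and}\qquad B_k^o(n)=C_k^o(n+1).$$
   Context: All partitions are of positive integers into positive parts unless stated otherwise. $B_k^e(n)$ (resp. $B_k^o(n)$) is the number of partitions of $n$ having at least one odd part, with largest odd part $2\ell-1$, in which every part is odd except for at most $k-1$ even parts. These even parts are pairwise distinct, lie in the interval $[2\ell+2,\,2\ell+2k-2]$, and their number is even (resp. odd). $C_k^e(n)$ (resp. $C_k^o(n)$) is the number of pairs $(\lambda,\ell)$ with $\ell\geq1$ and $\lambda$ a partition of $n$ satisfying three conditions: - $\lambda$ contains the part $2\ell$; - the parts of $\lambda$ not exceeding $\ell$ are pairwise distinct, while parts in $(\ell,2\ell]$ are unrestricted; - the parts of $\lambda$ larger than $2\ell$ are at most $k-1$ pairwise distinct even parts lying in $[2\ell+2,\,2\ell+2k-2]$, and their number is even (resp. odd). Equivalently, $\sum_{n}\big(\sum_m C_{k,m}(n)x^m\big)q^n=\sum_{\ell\ge1}\frac{(-q;q)_\ell(-xq^{2\ell+2};q^2)_{k-1}}{(q^{\ell+1};q)_\ell}q^{2\ell}$, where $C_{k,m}(n)$ counts those pairs with exactly $m$ parts larger than $2\ell$. Then $C_k^e$ and $C_k^o$ collect even and odd $m$ respectively. Here $(a;q)_N=\prod_{i=0}^{N-1}(1-aq^i)$. -}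

module Defs where

open import Data.List.Base
  using (List; []; _∷_; length; filter; deduplicate; concatMap; upTo; cartesianProduct)
open import Data.List.Membership.Propositional using (_∈_)
open import Data.List.Membership.Propositional.Properties
  using (∈-filter⁺; ∈-filter⁻; ∈-deduplicate⁺; ∈-deduplicate⁻; ∈-upTo⁺;
         ∈-cartesianProduct⁺; ∈-concatMap⁺)
import Data.List.Membership.DecPropositional as DecMembership
open import Data.List.Properties using (≡-dec)
open import Data.List.Relation.Unary.All using (All; []; _∷_; all?)
open import Data.List.Relation.Unary.Any using (here; there)
import Data.List.Relation.Unary.Any as Any
open import Data.List.Relation.Unary.Linked using (Linked; linked?)
open import Data.List.Relation.Unary.Unique.Propositional using (Unique)
open import Data.List.Relation.Unary.Unique.DecPropositional using (unique?)
open import Data.List.Relation.Unary.Unique.DecPropositional.Properties using (deduplicate-!)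
open import Data.Nat
open import Data.Nat.Divisibility using (_∣_; _∤_; _∣?_)
open import Data.Nat.ListAction using (sum)
open import Data.Nat.Properties
open import Data.Product using (_×_; _,_; ∃; ∃-syntax; proj₂)
import Data.Product.Properties as Product
open import Relation.Binary.Definitions using (DecidableEquality)
open import Relation.Binary.PropositionalEquality using (_≡_; refl)
open import Relation.Nullary using (Dec; ¬?; _×-dec_; _→-dec_)
open import Relation.Nullary.Decidable using (map′)
open import Relation.Unary using (Pred; Decidable)

Even Odd : Pred ℕ _
Even m = 2 ∣ m
Odd  m = 2 ∤ m

even? : Decidable Even
even? m = 2 ∣? m

odd? : Decidable Odd
odd? m = ¬? (even? m)

-- Partitions are represented by their weakly decreasing lists of parts, so that
-- equality of partitions is equality of lists.
IsPartition : ℕ → List ℕ → Set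
IsPartition n π = All (1 ≤_) π × Linked _≥_ π × sum π ≡ n

evenParts : List ℕ → List ℕ
evenParts = filter even?

partsUpTo partsAbove : ℕ → List ℕ → List ℕ
partsUpTo  b = filter (_≤? b)
partsAbove b = filter (b <?_)

IsLargestOddPart : ℕ → List ℕ → Set
IsLargestOddPart m π = Odd m × m ∈ π × All (λ p → Odd p → p ≤ m) π

-- For k = 1 the interval is empty (the subtraction is not truncated when k, ℓ ≥ 1).
AdmissibleEvens : (k ℓ : ℕ) → List ℕ → Set
AdmissibleEvens k ℓ ps =
    length ps ≤ k ∸ 1
  × Unique ps
  × All Even ps
  × All (λ p → 2 * ℓ + 2 ≤ p × p ≤ 2 * ℓ + 2 * k ∸ 2) ps

-- Q is the condition (Even or Odd) on the number of the distinguished even parts.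
InB : (Q : Pred ℕ _) (k n : ℕ) → List ℕ → Set
InB Q k n π =
    IsPartition n π
  × (∃[ ℓ ] 1 ≤ ℓ
          × IsLargestOddPart (2 * ℓ ∸ 1) π
          × AdmissibleEvens k ℓ (evenParts π))
  × Q (length (evenParts π))

InC : (Q : Pred ℕ _) (k n : ℕ) → List ℕ × ℕ → Set
InC Q k n (π , ℓ) =
    1 ≤ ℓ
  × IsPartition n π
  × 2 * ℓ ∈ π
  × Unique (partsUpTo ℓ π)
  × AdmissibleEvens k ℓ (partsAbove (2 * ℓ) π)
  × Q (length (partsAbove (2 * ℓ) π))

-- A duplicate-free list of exactly the elements satisfying P; its length is the
-- number of such elements.
record Enumeration {A : Set} (P : A → Set) : Set where
  field
    elements : List A
    unique   : Unique elements
    sound    : ∀ {x} → x ∈ elements → P x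
    complete : ∀ {x} → P x → x ∈ elements

  card : ℕ
  card = length elements

enumerate : {A : Set} {P : A → Set} → DecidableEquality A → Decidable P →
            (xs : List A) → (∀ {x} → P x → x ∈ xs) → Enumeration P
enumerate _≟A_ P? xs covers = record
  { elements = deduplicate _≟A_ (filter P? xs)
  ; unique   = deduplicate-! _≟A_ (filter P? xs)
  ; sound    = λ x∈ → proj₂ (∈-filter⁻ P? {xs = xs} (∈-deduplicate⁻ _≟A_ (filter P? xs) x∈))
  ; complete = λ Px → ∈-deduplicate⁺ _≟A_ (∈-filter⁺ P? (covers Px) Px)
  }

∈⇒≤sum : ∀ {m π} → m ∈ π → m ≤ sum π
∈⇒≤sum {π = p ∷ π} (here refl) = m≤m+n p (sum π)
∈⇒≤sum {π = p ∷ π} (there m∈π) = ≤-trans (∈⇒≤sum m∈π) (m≤n+m (sum π) p)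

extend : List ℕ → List (List ℕ)
extend []      = (1 ∷ []) ∷ []
extend (p ∷ π) = (1 ∷ p ∷ π) ∷ (suc p ∷ π) ∷ []

compositions : ℕ → List (List ℕ)
compositions zero    = [] ∷ []
compositions (suc n) = concatMap extend (compositions n)

∈-compositions : ∀ n π → All (1 ≤_) π → sum π ≡ n → π ∈ compositions n
∈-compositions zero    []                _         _  = here refl
∈-compositions zero    (suc _ ∷ _)       _         ()
∈-compositions zero    (zero ∷ _)        (() ∷ _)  _
∈-compositions (suc n) (zero ∷ _)        (() ∷ _)  _
∈-compositions (suc n) (suc zero ∷ π)    (_ ∷ pos) eq =
  ∈-concatMap⁺ extend (Any.map (λ { refl → 1∷∈ π }) (∈-compositions n π pos (suc-injective eq)))
  where
  1∷∈ : ∀ π → 1 ∷ π ∈ extend π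
  1∷∈ []      = here refl
  1∷∈ (_ ∷ _) = here refl
∈-compositions (suc n) (suc (suc p) ∷ π) (_ ∷ pos) eq =
  ∈-concatMap⁺ extend
    (Any.map (λ { refl → there (here refl) })
      (∈-compositions n (suc p ∷ π) (s≤s z≤n ∷ pos) (suc-injective eq)))

partition? : ∀ n → Decidable (IsPartition n)
partition? n π = all? (1 ≤?_) π ×-dec linked? _≥?_ π ×-dec (sum π ≟ n)

largestOddPart? : ∀ m → Decidable (IsLargestOddPart m)
largestOddPart? m π =
  odd? m ×-dec DecMembership._∈?_ _≟_ m π ×-dec all? (λ p → odd? p →-dec (p ≤? m)) π

admissibleEvens? : ∀ k ℓ → Decidable (AdmissibleEvens k ℓ)
admissibleEvens? k ℓ ps =
  (length ps ≤? k ∸ 1) ×-dec unique? _≟_ ps ×-dec all? even? ps ×-dec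
  all? (λ p → (2 * ℓ + 2 ≤? p) ×-dec (p ≤? 2 * ℓ + 2 * k ∸ 2)) ps

ℓ≤2ℓ∸1 : ∀ {ℓ} → 1 ≤ ℓ → ℓ ≤ 2 * ℓ ∸ 1
ℓ≤2ℓ∸1 {suc ℓ} _ = ≤-trans (m≤n+m (suc ℓ) ℓ) (+-monoʳ-≤ ℓ (s≤s (m≤m+n ℓ 0)))

inB? : ∀ {Q} → Decidable Q → ∀ k n → Decidable (InB Q k n)
inB? Q? k n π = partition? n π ×-dec ∃ℓ? ×-dec Q? (length (evenParts π))
  where
  R : ℕ → Set
  R ℓ = 1 ≤ ℓ × IsLargestOddPart (2 * ℓ ∸ 1) π × AdmissibleEvens k ℓ (evenParts π)

  R? : Decidable R
  R? ℓ = (1 ≤? ℓ) ×-dec largestOddPart? (2 * ℓ ∸ 1) π ×-dec admissibleEvens? k ℓ (evenParts π)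

  bound : ∀ {ℓ} → R ℓ → ℓ < suc (sum π)
  bound (1≤ℓ , (_ , m∈π , _) , _) = s≤s (≤-trans (ℓ≤2ℓ∸1 1≤ℓ) (∈⇒≤sum m∈π))

  ∃ℓ? : Dec (∃ R)
  ∃ℓ? = map′ (λ (ℓ , _ , r) → ℓ , r) (λ (ℓ , r) → ℓ , bound r , r) (anyUpTo? R? (suc (sum π)))

inC? : ∀ {Q} → Decidable Q → ∀ k n → Decidable (InC Q k n)
inC? Q? k n (π , ℓ) =
  (1 ≤? ℓ) ×-dec partition? n π ×-dec DecMembership._∈?_ _≟_ (2 * ℓ) π ×-dec
  unique? _≟_ (partsUpTo ℓ π) ×-dec admissibleEvens? k ℓ (partsAbove (2 * ℓ) π) ×-dec
  Q? (length (partsAbove (2 * ℓ) π))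

enumB : ∀ {Q} → Decidable Q → ∀ k n → Enumeration (InB Q k n)
enumB Q? k n = enumerate (≡-dec _≟_) (inB? Q? k n) (compositions n)
  λ ((pos , _ , eq) , _) → ∈-compositions n _ pos eq

enumC : ∀ {Q} → Decidable Q → ∀ k n → Enumeration (InC Q k n)
enumC Q? k n = enumerate (Product.≡-dec (≡-dec _≟_) _≟_) (inC? Q? k n)
  (cartesianProduct (compositions n) (upTo (suc n)))
  λ { {π , ℓ} (_ , (pos , _ , refl) , 2ℓ∈π , _) →
      ∈-cartesianProduct⁺ (∈-compositions n π pos refl)
        (∈-upTo⁺ (s≤s (≤-trans (m≤m+n ℓ (ℓ + 0)) (∈⇒≤sum 2ℓ∈π)))) }

Bᵉ Bᵒ Cᵉ Cᵒ : (k n : ℕ) → ℕ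
Bᵉ k n = Enumeration.card (enumB even? k n)
Bᵒ k n = Enumeration.card (enumB odd? k n)
Cᵉ k n = Enumeration.card (enumC even? k n)
Cᵒ k n = Enumeration.card (enumC odd? k n)

{-# OPTIONS --safe #-}

-- Fix ℓ.  Since the distinguished even parts E exceed all the others, a partition
-- counted by B is E ++ (2ℓ-1) ∷ O with O an arbitrary list of odd parts below 2ℓ, and
-- one counted by C is E ++ 2ℓ ∷ S with the parts of S at most 2ℓ and those at most ℓ
-- distinct.  The lists O correspond to the lists S by binary carrying: for
-- j = 1, …, ℓ in turn, replace pairs of parts j by parts 2j.  When step j starts, 2j
-- is not yet a part, so the step is undone by splitting every 2j.  Carrying
-- preserves the sum, and exchanging 2ℓ-1 for 2ℓ adds one.
module Submission where

open import Defs
open import Data.List.Base using (List; []; _∷_; _++_; length; filter; replicate)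
open import Data.List.Membership.Propositional using (_∈_)
open import Data.List.Membership.Propositional.Properties
  using (∈-++⁺ˡ; ∈-++⁺ʳ; ∈-++⁻; ∈-∃++; ∈-filter⁺)
open import Data.List.Properties
  using (filter-++; filter-all; filter-none; filter-some; filter-reject; length-++;
         ++-identityʳ; ++-cancelˡ; ∷-injective)
open import Data.List.Relation.Binary.Permutation.Propositional using (_↭_; ↭-sym)
open import Data.List.Relation.Binary.Permutation.Propositional.Properties
  using (All-resp-↭; filter-↭; ↭-length)
open import Data.List.Relation.Unary.All as All using (All; []; _∷_)
import Data.List.Relation.Unary.All.Properties as All
open import Data.List.Relation.Unary.AllPairs as AllPairs using (AllPairs; []; _∷_)
import Data.List.Relation.Unary.AllPairs.Properties as AllPairs
open import Data.List.Relation.Unary.Any using (here; there)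
open import Data.List.Relation.Unary.Linked.Properties using (AllPairs⇒Linked; Linked⇒AllPairs)
open import Data.List.Relation.Unary.Unique.Propositional using (Unique)
import Data.List.Sort
open import Data.Nat
open import Data.Nat.Divisibility
  using (_∣_; divides; m∣m*n; n∣m*n; ∣m+n∣m⇒∣n; ∣1⇒≡1; _∣0)
open import Data.Nat.DivMod
open import Data.Nat.ListAction using (sum)
open import Data.Nat.ListAction.Properties using (sum-++; sum-↭)
open import Data.Nat.Properties
open import Data.Nat.Tactic.RingSolver using (solve-∀)
open import Data.Product using (_×_; _,_; ∃; proj₁; proj₂; map₂)
open import Data.Product.Properties using (,-injective)
open import Data.Sum using (inj₁; inj₂)
open import Function using (_∘_; id)
open import Level using (0ℓ)
open import Relation.Binary.Construct.Flip.EqAndOrd using (decTotalOrder)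
open import Relation.Binary.Definitions using (DecidableEquality)
open import Relation.Binary.PropositionalEquality
open import Relation.Nullary using (¬_; ¬?; yes; no; contradiction)
open import Relation.Unary using (Pred; Decidable)

open Data.List.Sort (decTotalOrder ≤-decTotalOrder) using (sort; sort-↭; sort-↗)

-- Comparing finite cardinalities through a relation.

module _ {A B : Set} (_~_ : A → B → Set)
         (injective : ∀ {x x′ y} → x ~ y → x′ ~ y → x ≡ x′) where

  -- Pigeonhole, by induction on `xs`: one occurrence of a partner of the head is deleted from `ys`,
  -- and the remaining entries still have partners in what is left.
  length-≤-by-injective : ∀ {xs : List A} (ys : List B) → Unique xs →
    (∀ {x} → x ∈ xs → ∃ λ y → y ∈ ys × x ~ y) → length xs ≤ length ys
  length-≤-by-injective ys [] _ = z≤n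
  length-≤-by-injective {x ∷ xs} ys (x∉xs ∷ xs!) f
    with y , y∈ys , x~y ← f (here refl)
    with as , bs , refl ← ∈-∃++ y∈ys = begin
      suc (length xs)               ≤⟨ s≤s (length-≤-by-injective (as ++ bs) xs! f′) ⟩
      suc (length (as ++ bs))       ≡⟨ cong suc (length-++ as) ⟩
      suc (length as + length bs)   ≡⟨ +-suc (length as) (length bs) ⟨
      length as + suc (length bs)   ≡⟨ length-++ as ⟨
      length (as ++ y ∷ bs)         ∎
    where
    open ≤-Reasoning
    f′ : ∀ {x′} → x′ ∈ xs → ∃ λ y′ → y′ ∈ as ++ bs × x′ ~ y′
    f′ x′∈xs with y′ , y′∈ , x′~y′ ← f (there x′∈xs) with ∈-++⁻ as y′∈
    ... | inj₁ y′∈as         = y′ , ∈-++⁺ˡ y′∈as , x′~y′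
    ... | inj₂ (there y′∈bs) = y′ , ∈-++⁺ʳ as y′∈bs , x′~y′
    -- A later entry that needs the deleted occurrence would share its partner with the head and so
    -- equal it, against uniqueness.
    ... | inj₂ (here refl)   = contradiction (injective x~y x′~y′) (All.lookup x∉xs x′∈xs)

  -- Phrased for a relation so that a single correspondence, read in both directions, yields both
  -- inequalities between two counts.
  card-≤-by-injective : ∀ {P : A → Set} {Q : B → Set} (p : Enumeration P) (q : Enumeration Q) →
    (∀ {x} → P x → ∃ λ y → Q y × x ~ y) → Enumeration.card p ≤ Enumeration.card q
  card-≤-by-injective p q f =
    length-≤-by-injective (elements q) (unique p)
      λ x∈ → let y , Qy , x~y = f (sound p x∈) in y , complete q Qy , x~y
    where open Enumeration

-- Multiplicities

-- Abstract, because _≟_ on ℕ computes to a Boolean test that with cannot abstract.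
infix 4 _≡?_
abstract
  _≡?_ : DecidableEquality ℕ
  _≡?_ = _≟_

mult : ℕ → List ℕ → ℕ
mult p xs = length (filter (p ≡?_) xs)

infix 4 _≈_
-- Equality of multisets, put so that it can be checked one part size at a time.
_≈_ : List ℕ → List ℕ → Set
xs ≈ ys = ∀ p → mult p xs ≡ mult p ys

↭⇒≈ : ∀ {xs ys} → xs ↭ ys → xs ≈ ys
↭⇒≈ xs↭ys p = ↭-length (filter-↭ (p ≡?_) xs↭ys)

mult-++ : ∀ p xs ys → mult p (xs ++ ys) ≡ mult p xs + mult p ys
mult-++ p xs ys =
  trans (cong length (filter-++ (p ≡?_) xs ys)) (length-++ (filter (p ≡?_) xs))

mult-∷ : ∀ p x {xs ys} → mult p (x ∷ xs) ≡ mult p (x ∷ ys) → mult p xs ≡ mult p ys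
mult-∷ p x eq with p ≡? x
... | yes _ = suc-injective eq
... | no  _ = eq

mult-replicate : ∀ n p → mult p (replicate n p) ≡ n
mult-replicate zero    p = refl
mult-replicate (suc n) p with p ≡? p
... | yes _   = cong suc (mult-replicate n p)
... | no  p≢p = contradiction refl p≢p

All≢⇒mult≡0 : ∀ {p xs} → All (p ≢_) xs → mult p xs ≡ 0
All≢⇒mult≡0 {p} ≢s = cong length (filter-none (p ≡?_) ≢s)

mult-replicate-≢ : ∀ n {p q} → p ≢ q → mult p (replicate n q) ≡ 0
mult-replicate-≢ n p≢q = All≢⇒mult≡0 (All.replicate⁺ n p≢q)

∈⇒0<mult : ∀ {p xs} → p ∈ xs → 0 < mult p xs
∈⇒0<mult {p} p∈xs = filter-some (p ≡?_) p∈xs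

0<mult⇒∈ : ∀ {p} xs → 0 < mult p xs → p ∈ xs
0<mult⇒∈ {p} (x ∷ xs) 0< with p ≡? x
... | yes p≡x = here p≡x
... | no  _   = there (0<mult⇒∈ xs 0<)

module _ {P : Pred ℕ 0ℓ} (P? : Decidable P) where

  mult-filter : ∀ {p} → P p → ∀ xs → mult p (filter P? xs) ≡ mult p xs
  mult-filter Pp []       = refl
  mult-filter {p} Pp (x ∷ xs) with P? x
  ... | no ¬Px with p ≡? x
  ...   | yes refl = contradiction Pp ¬Px
  ...   | no  _    = mult-filter Pp xs
  mult-filter {p} Pp (x ∷ xs) | yes _ with p ≡? x
  ...   | yes _    = cong suc (mult-filter Pp xs)
  ...   | no  _    = mult-filter Pp xs

  mult-filter-¬ : ∀ {p} → ¬ P p → ∀ xs → mult p (filter P? xs) ≡ 0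
  mult-filter-¬ ¬Pp xs =
    All≢⇒mult≡0 (All.map (λ Px p≡x → ¬Pp (subst P (sym p≡x) Px)) (All.all-filter P? xs))

Unique⇒mult≤1 : ∀ {xs} → Unique xs → ∀ p → mult p xs ≤ 1
Unique⇒mult≤1 []            p = z≤n
Unique⇒mult≤1 (_∷_ {x} x∉xs xs!) p with p ≡? x
... | yes refl = s≤s (≤-reflexive (All≢⇒mult≡0 x∉xs))
... | no  _    = Unique⇒mult≤1 xs! p

mult≤1⇒Unique : ∀ xs → (∀ p → mult p xs ≤ 1) → Unique xs
mult≤1⇒Unique []       _  = []
mult≤1⇒Unique (x ∷ xs) ≤1 = All.tabulate x∉xs ∷ mult≤1⇒Unique xs ≤1′
  where
  x∉xs : ∀ {y} → y ∈ xs → x ≢ y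
  x∉xs y∈xs refl with x ≡? x | ≤1 x
  ... | yes _   | s≤s ≤0 = contradiction (∈⇒0<mult y∈xs) (≤⇒≯ ≤0)
  ... | no  x≢x | _      = contradiction refl x≢x
  ≤1′ : ∀ p → mult p xs ≤ 1
  ≤1′ p with p ≡? x | ≤1 p
  ... | yes _ | s≤s ≤0 = ≤-trans ≤0 z≤n
  ... | no  _ | ≤1p    = ≤1p

-- Weakly decreasing lists

Decreasing : List ℕ → Set
Decreasing = AllPairs _≥_

sort-decreasing : ∀ xs → Decreasing (sort xs)
sort-decreasing xs = Linked⇒AllPairs (λ i≥j j≥k → ≤-trans j≥k i≥j) (sort-↗ xs)

∈⇒≤head : ∀ {x y xs} → Decreasing (x ∷ xs) → y ∈ x ∷ xs → y ≤ x
∈⇒≤head _           (here refl)  = ≤-refl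
∈⇒≤head (x≥xs ∷ _) (there y∈xs) = All.lookup x≥xs y∈xs

-- Each head is the maximum of its list, and equal multiplicities place it in the other list too.
-- Hence the heads agree and can be cancelled.
decreasing-unique : ∀ {xs ys} → Decreasing xs → Decreasing ys → xs ≈ ys → xs ≡ ys
decreasing-unique {[]}     {[]}     _   _   _  = refl
decreasing-unique {[]}     {y ∷ ys} _   _   eq =
  contradiction (subst (0 <_) (sym (eq y)) (∈⇒0<mult (here {xs = ys} refl))) λ ()
decreasing-unique {x ∷ xs} {[]}     _   _   eq =
  contradiction (subst (0 <_) (eq x) (∈⇒0<mult (here {xs = xs} refl))) λ ()
decreasing-unique {x ∷ xs} {y ∷ ys} xs↘ ys↘ eq
  with refl ← ≤-antisym
    (∈⇒≤head ys↘ (0<mult⇒∈ (y ∷ ys) (subst (0 <_) (eq x) (∈⇒0<mult (here {xs = xs} refl)))))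
    (∈⇒≤head xs↘ (0<mult⇒∈ (x ∷ xs) (subst (0 <_) (sym (eq y)) (∈⇒0<mult (here {xs = ys} refl)))))
  = cong (x ∷_) (decreasing-unique (AllPairs.tail xs↘) (AllPairs.tail ys↘) λ p → mult-∷ p x (eq p))

-- Used to bring the distinguished part, `2 * ℓ ∸ 1` or `2 * ℓ`, to the front of the block that it
-- dominates.
decreasing-with-max : ∀ {m xs} → Decreasing xs → m ∈ xs → All (_≤ m) xs → ∃ λ ys → xs ≡ m ∷ ys
decreasing-with-max {xs = x ∷ xs} xs↘ m∈ (x≤m ∷ _) =
  xs , cong (_∷ xs) (≤-antisym x≤m (∈⇒≤head xs↘ m∈))

++-decreasing : ∀ {b xs ys} → Decreasing xs → Decreasing ys →
                All (b <_) xs → All (_≤ b) ys → Decreasing (xs ++ ys)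
++-decreasing xs↘ ys↘ b<xs ys≤b =
  AllPairs.++⁺ xs↘ ys↘
    (All.map (λ b<x → All.map (λ y≤b → ≤-trans y≤b (<⇒≤ b<x)) ys≤b) b<xs)

module _ {P : Pred ℕ 0ℓ} (P? : Decidable P) where

  filter-prefix : ∀ {xs ys} → All P xs → All (¬_ ∘ P) ys → filter P? (xs ++ ys) ≡ xs
  filter-prefix {xs} {ys} Pxs ¬Pys = begin
    filter P? (xs ++ ys)           ≡⟨ filter-++ P? xs ys ⟩
    filter P? xs ++ filter P? ys   ≡⟨ cong₂ _++_ (filter-all P? Pxs) (filter-none P? ¬Pys) ⟩
    xs ++ []                       ≡⟨ ++-identityʳ xs ⟩
    xs                             ∎
    where open ≡-Reasoning

  -- Entries above the threshold `b` come first in a decreasing list, and `b` separates the entries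
  -- with `P` from those without. So concatenating the two sublists restores the original order.
  decreasing-cut : ∀ b {xs} → Decreasing xs → All (λ x → P x → b < x) xs →
                   All (λ x → ¬ P x → x ≤ b) xs →
                   xs ≡ filter P? xs ++ filter (¬? ∘ P?) xs
  decreasing-cut b []            []       []       = refl
  decreasing-cut b {x ∷ xs} (x≥xs ∷ xs↘) (hi ∷ his) (lo ∷ los) with P? x
  ... | yes _ = cong (x ∷_) (decreasing-cut b xs↘ his los)
  -- The first entry without `P` is at most `b` and bounds all later ones, so `P` fails from here
  -- on.
  ... | no ¬Px = sym (cong₂ _++_ (filter-none P? ¬Pxs) (cong (x ∷_) (filter-all (¬? ∘ P?) ¬Pxs)))
    where
    ¬Pxs : All (¬_ ∘ P) xs
    ¬Pxs = All.zipWith (λ (x≥y , hi) Py → <⇒≱ (hi Py) (≤-trans x≥y (lo ¬Px))) (x≥xs , his)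

-- Carrying

without : ℕ → List ℕ → List ℕ
without j = filter (¬? ∘ (j ≡?_))

-- The order of the resulting parts is immaterial: lists are compared by multiplicities until
-- `carried` and `uncarried` sort them. The two maps invert each other only under the side
-- conditions of `uncarry-carry` and `carry-uncarry`.
carry uncarry : ℕ → List ℕ → List ℕ
carry j xs =
  replicate (mult j xs / 2) (2 * j) ++ replicate (mult j xs % 2) j ++ without j xs
uncarry j xs = replicate (mult (2 * j) xs * 2) j ++ without (2 * j) xs

sum-replicate : ∀ n p → sum (replicate n p) ≡ n * p
sum-replicate zero    p = refl
sum-replicate (suc n) p = cong (p +_) (sum-replicate n p)

sum-without : ∀ j xs → mult j xs * j + sum (without j xs) ≡ sum xs
sum-without j []       = refl
sum-without j (x ∷ xs) with j ≡? x
... | yes refl = trans (+-assoc j _ _) (cong (j +_) (sum-without j xs))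
... | no  _    = trans (swap-+ (mult j xs * j) x _) (cong (x +_) (sum-without j xs))
  where
  swap-+ : ∀ a b c → a + (b + c) ≡ b + (a + c)
  swap-+ = solve-∀

sum-carry : ∀ j xs → sum (carry j xs) ≡ sum xs
sum-carry j xs = begin
  sum (replicate h (2 * j) ++ replicate r j ++ ys)
    ≡⟨ sum-++ (replicate h (2 * j)) _ ⟩
  sum (replicate h (2 * j)) + sum (replicate r j ++ ys)
    ≡⟨ cong₂ _+_ (sum-replicate h (2 * j))
                 (trans (sum-++ (replicate r j) ys) (cong (_+ sum ys) (sum-replicate r j))) ⟩
  h * (2 * j) + (r * j + sum ys)
    ≡⟨ regroup h j r (sum ys) ⟩
  (r + h * 2) * j + sum ys
    -- Division with remainder: `h` parts `2 * j` and `r` parts `j` weigh as much as the original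
    -- copies of `j`.
    ≡⟨ cong (λ c → c * j + sum ys) (m≡m%n+[m/n]*n (mult j xs) 2) ⟨
  mult j xs * j + sum ys
    ≡⟨ sum-without j xs ⟩
  sum xs ∎
  where
  open ≡-Reasoning
  h = mult j xs / 2
  r = mult j xs % 2
  ys = without j xs
  regroup : ∀ h j r s → h * (2 * j) + (r * j + s) ≡ (r + h * 2) * j + s
  regroup = solve-∀

-- Multiplicities after a single step.

j≢2*j : ∀ j .{{_ : NonZero j}} → j ≢ 2 * j
j≢2*j (suc j) = <⇒≢ (m<m+n (suc j) (s≤s z≤n))

mult-carry-++ : ∀ p j xs → mult p (carry j xs) ≡
  mult p (replicate (mult j xs / 2) (2 * j)) +
  (mult p (replicate (mult j xs % 2) j) + mult p (without j xs))
mult-carry-++ p j xs =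
  trans (mult-++ p (replicate (mult j xs / 2) (2 * j)) _)
        (cong (mult p (replicate (mult j xs / 2) (2 * j)) +_)
          (mult-++ p (replicate (mult j xs % 2) j) (without j xs)))

mult-uncarry-++ : ∀ p j xs → mult p (uncarry j xs) ≡
  mult p (replicate (mult (2 * j) xs * 2) j) + mult p (without (2 * j) xs)
mult-uncarry-++ p j xs = mult-++ p (replicate (mult (2 * j) xs * 2) j) _

mult-without-self : ∀ j xs → mult j (without j xs) ≡ 0
mult-without-self j = mult-filter-¬ (¬? ∘ (j ≡?_)) (λ j≢j → j≢j refl)

mult-without : ∀ {p j} → p ≢ j → ∀ xs → mult p (without j xs) ≡ mult p xs
mult-without {j = j} p≢j = mult-filter (¬? ∘ (j ≡?_)) (p≢j ∘ sym)

module _ (j : ℕ) .{{_ : NonZero j}} (xs : List ℕ) where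

  mult-carry : mult j (carry j xs) ≡ mult j xs % 2
  mult-carry = trans (mult-carry-++ j j xs) (trans
    (cong₂ _+_ (mult-replicate-≢ (mult j xs / 2) (j≢2*j j))
      (cong₂ _+_ (mult-replicate (mult j xs % 2) j) (mult-without-self j xs)))
    (+-identityʳ (mult j xs % 2)))

  mult-carry-double : mult (2 * j) (carry j xs) ≡ mult j xs / 2 + mult (2 * j) xs
  mult-carry-double = trans (mult-carry-++ (2 * j) j xs)
    (cong₂ _+_ (mult-replicate (mult j xs / 2) (2 * j))
      (cong₂ _+_ (mult-replicate-≢ (mult j xs % 2) (≢-sym (j≢2*j j))) (mult-without (≢-sym (j≢2*j j)) xs)))

  mult-carry-other : ∀ {p} → p ≢ j → p ≢ 2 * j → mult p (carry j xs) ≡ mult p xs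
  mult-carry-other {p} p≢j p≢2j = trans (mult-carry-++ p j xs)
    (cong₂ _+_ (mult-replicate-≢ (mult j xs / 2) p≢2j)
      (cong₂ _+_ (mult-replicate-≢ (mult j xs % 2) p≢j) (mult-without p≢j xs)))

  mult-uncarry : mult j (uncarry j xs) ≡ mult (2 * j) xs * 2 + mult j xs
  mult-uncarry = trans (mult-uncarry-++ j j xs)
    (cong₂ _+_ (mult-replicate (mult (2 * j) xs * 2) j) (mult-without (j≢2*j j) xs))

  mult-uncarry-double : mult (2 * j) (uncarry j xs) ≡ 0
  mult-uncarry-double = trans (mult-uncarry-++ (2 * j) j xs)
    (cong₂ _+_ (mult-replicate-≢ (mult (2 * j) xs * 2) (≢-sym (j≢2*j j))) (mult-without-self (2 * j) xs))

  mult-uncarry-other : ∀ {p} → p ≢ j → p ≢ 2 * j → mult p (uncarry j xs) ≡ mult p xs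
  mult-uncarry-other {p} p≢j p≢2j = trans (mult-uncarry-++ p j xs)
    (cong₂ _+_ (mult-replicate-≢ (mult (2 * j) xs * 2) p≢j) (mult-without p≢2j xs))

-- A step alters only the multiplicities of `j` and `2 * j`, so claims about its result split into
-- these two sizes and all others.
by-position : ∀ (P : ℕ → Set) j → P j → P (2 * j) → (∀ {p} → p ≢ j → p ≢ 2 * j → P p) → ∀ p → P p
by-position P j Pj P2j other p with p ≡? j | p ≡? 2 * j
... | yes refl | _        = Pj
... | no  _    | yes refl = P2j
... | no  p≢j  | no  p≢2j = other p≢j p≢2j

-- Every multiplicity after the step is determined by the multiplicities before it, so carrying acts
-- on multisets.
carry-cong : ∀ j .{{_ : NonZero j}} {xs ys} → xs ≈ ys → carry j xs ≈ carry j ys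
carry-cong j {xs} {ys} eq = by-position _ j
  (trans (mult-carry j xs) (trans (cong (_% 2) (eq j)) (sym (mult-carry j ys))))
  (trans (mult-carry-double j xs)
    (trans (cong₂ (λ a b → a / 2 + b) (eq j) (eq (2 * j))) (sym (mult-carry-double j ys))))
  (λ {p} p≢j p≢2j → trans (mult-carry-other j xs p≢j p≢2j)
    (trans (eq p) (sym (mult-carry-other j ys p≢j p≢2j))))

uncarry-cong : ∀ j .{{_ : NonZero j}} {xs ys} → xs ≈ ys → uncarry j xs ≈ uncarry j ys
uncarry-cong j {xs} {ys} eq = by-position _ j
  (trans (mult-uncarry j xs)
    (trans (cong₂ (λ a b → a * 2 + b) (eq (2 * j)) (eq j)) (sym (mult-uncarry j ys))))
  (trans (mult-uncarry-double j xs) (sym (mult-uncarry-double j ys)))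
  (λ {p} p≢j p≢2j → trans (mult-uncarry-other j xs p≢j p≢2j)
    (trans (eq p) (sym (mult-uncarry-other j ys p≢j p≢2j))))

-- With no part `2 * j` beforehand, all such parts after the step are carries. Splitting every one
-- of them turns quotient and remainder back into the old multiplicity of `j`.
uncarry-carry : ∀ j .{{_ : NonZero j}} xs → mult (2 * j) xs ≡ 0 → uncarry j (carry j xs) ≈ xs
uncarry-carry j xs none = by-position _ j
  (begin
    mult j (uncarry j (carry j xs))                         ≡⟨ mult-uncarry j (carry j xs) ⟩
    mult (2 * j) (carry j xs) * 2 + mult j (carry j xs)     ≡⟨ cong₂ (λ a b → a * 2 + b) double (mult-carry j xs) ⟩
    mult j xs / 2 * 2 + mult j xs % 2                       ≡⟨ +-comm (mult j xs / 2 * 2) _ ⟩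
    mult j xs % 2 + mult j xs / 2 * 2                       ≡⟨ m≡m%n+[m/n]*n (mult j xs) 2 ⟨
    mult j xs                                               ∎)
  (trans (mult-uncarry-double j (carry j xs)) (sym none))
  (λ p≢j p≢2j → trans (mult-uncarry-other j (carry j xs) p≢j p≢2j) (mult-carry-other j xs p≢j p≢2j))
  where
  open ≡-Reasoning
  double : mult (2 * j) (carry j xs) ≡ mult j xs / 2
  double = trans (mult-carry-double j xs) (trans (cong (mult j xs / 2 +_) none) (+-identityʳ _))

[d*2+e]%2 : ∀ d {e} → e ≤ 1 → (d * 2 + e) % 2 ≡ e
[d*2+e]%2 d {e} e≤1 = begin
  (d * 2 + e) % 2   ≡⟨ cong (_% 2) (+-comm (d * 2) e) ⟩
  (e + d * 2) % 2   ≡⟨ [m+kn]%n≡m%n e d 2 ⟩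
  e % 2             ≡⟨ m<n⇒m%n≡m (s≤s e≤1) ⟩
  e                 ∎
  where open ≡-Reasoning

[d*2+e]/2 : ∀ d {e} → e ≤ 1 → (d * 2 + e) / 2 ≡ d
[d*2+e]/2 d {e} e≤1 = begin
  (d * 2 + e) / 2       ≡⟨ +-distrib-/-∣ˡ e (n∣m*n d) ⟩
  d * 2 / 2 + e / 2     ≡⟨ cong₂ _+_ (m*n/n≡m d 2) (m<n⇒m/n≡0 (s≤s e≤1)) ⟩
  d + 0                 ≡⟨ +-identityʳ d ⟩
  d                     ∎
  where open ≡-Reasoning

-- Splitting `d` parts `2 * j` beside `e` parts `j` gives `d * 2 + e` copies of `j`. As `e` is at
-- most 1, division by 2 returns exactly `d` and `e`.
carry-uncarry : ∀ j .{{_ : NonZero j}} xs → mult j xs ≤ 1 → carry j (uncarry j xs) ≈ xs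
carry-uncarry j xs e≤1 = by-position _ j
  (trans (mult-carry j (uncarry j xs))
    (trans (cong (_% 2) (mult-uncarry j xs)) ([d*2+e]%2 (mult (2 * j) xs) e≤1)))
  (begin
    mult (2 * j) (carry j (uncarry j xs))
      ≡⟨ mult-carry-double j (uncarry j xs) ⟩
    mult j (uncarry j xs) / 2 + mult (2 * j) (uncarry j xs)
      ≡⟨ cong₂ (λ a b → a / 2 + b) (mult-uncarry j xs) (mult-uncarry-double j xs) ⟩
    (mult (2 * j) xs * 2 + mult j xs) / 2 + 0
      ≡⟨ +-identityʳ _ ⟩
    (mult (2 * j) xs * 2 + mult j xs) / 2
      ≡⟨ [d*2+e]/2 (mult (2 * j) xs) e≤1 ⟩
    mult (2 * j) xs ∎)
  (λ p≢j p≢2j → trans (mult-carry-other j (uncarry j xs) p≢j p≢2j) (mult-uncarry-other j xs p≢j p≢2j))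
  where open ≡-Reasoning

-- Composition of the steps, the smallest size carrying first.

carries uncarries : ℕ → List ℕ → List ℕ
carries zero    xs = xs
carries (suc j) xs = carry (suc j) (carries j xs)
uncarries zero    xs = xs
uncarries (suc j) xs = uncarries j (uncarry (suc j) xs)

sum-carries : ∀ j xs → sum (carries j xs) ≡ sum xs
sum-carries zero    xs = refl
sum-carries (suc j) xs = trans (sum-carry (suc j) (carries j xs)) (sum-carries j xs)

carries-cong : ∀ j {xs ys} → xs ≈ ys → carries j xs ≈ carries j ys
carries-cong zero    eq = eq
carries-cong (suc j) {xs} {ys} eq =
  carry-cong (suc j) {carries j xs} {carries j ys} (carries-cong j {xs} {ys} eq)

uncarries-cong : ∀ j {xs ys} → xs ≈ ys → uncarries j xs ≈ uncarries j ys
uncarries-cong zero    eq = eq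
uncarries-cong (suc j) {xs} {ys} eq =
  uncarries-cong j {uncarry (suc j) xs} {uncarry (suc j) ys} (uncarry-cong (suc j) {xs} {ys} eq)

-- The lists between the carrying steps j and j + 1: for j = 0 all parts are odd, for
-- j = ℓ the last condition is void.
record Stage (ℓ j : ℕ) (xs : List ℕ) : Set where
  constructor stage
  field
    bounded  : All (λ p → 1 ≤ p × p ≤ 2 * ℓ) xs
    distinct : ∀ {p} → p ≤ j → mult p xs ≤ 1
    odd-part : ∀ {p} → j < p → mult (2 * p) xs ≡ 0

Stage-resp-↭ : ∀ {ℓ j xs ys} → xs ↭ ys → Stage ℓ j xs → Stage ℓ j ys
Stage-resp-↭ xs↭ys (stage bounded distinct odd-part) = stage
  (All-resp-↭ xs↭ys bounded)
  (λ {p} p≤j → subst (_≤ 1) (↭⇒≈ xs↭ys p) (distinct p≤j))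
  (λ {p} j<p → trans (sym (↭⇒≈ xs↭ys (2 * p))) (odd-part j<p))

2*-≢ : ∀ {p q} → q < p → 2 * p ≢ q
2*-≢ {p} q<p = >⇒≢ (≤-trans q<p (m≤m+n p _))

2*-≢-2* : ∀ {p q} → q < p → 2 * p ≢ 2 * q
2*-≢-2* q<p = >⇒≢ (*-monoʳ-< 2 q<p)

-- The step leaves at most one part `suc j`. The parts that it creates have size `2 * suc j`, which
-- is within the bound `2 * ℓ`, above the sizes required to be distinct, and different from `2 * p`
-- for every later `p`.
carry-stage : ∀ {ℓ j xs} → suc j ≤ ℓ → Stage ℓ j xs → Stage ℓ (suc j) (carry (suc j) xs)
carry-stage {ℓ} {j} {xs} j<ℓ (stage bounded distinct odd-part) = stage
  (All.++⁺ (All.replicate⁺ (mult (suc j) xs / 2) (s≤s z≤n , *-monoʳ-≤ 2 j<ℓ))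
    (All.++⁺ (All.replicate⁺ (mult (suc j) xs % 2) (s≤s z≤n , ≤-trans j<ℓ (m≤m+n ℓ _)))
      (All.filter⁺ (¬? ∘ (suc j ≡?_)) bounded)))
  (λ {p} → by-position (λ p → p ≤ suc j → mult p (carry (suc j) xs) ≤ 1) (suc j)
    (λ _ → subst (_≤ 1) (sym (mult-carry (suc j) xs)) (s≤s⁻¹ (m%n<n (mult (suc j) xs) 2)))
    -- The doubled size exceeds `suc j`, so distinctness claims nothing about it.
    (λ 2*≤ → contradiction 2*≤ (<⇒≱ (m<m+n (suc j) (s≤s z≤n))))
    (λ p≢ p≢2* p≤ → subst (_≤ 1) (sym (mult-carry-other (suc j) xs p≢ p≢2*))
                       (distinct (s≤s⁻¹ (≤∧≢⇒< p≤ p≢))))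
    p)
  (λ j<p → trans (mult-carry-other (suc j) xs (2*-≢ j<p) (2*-≢-2* j<p)) (odd-part (<⇒≤ j<p)))

-- Sizes up to `j` are untouched. Doubles of sizes beyond `suc j` were already absent, and all parts
-- `2 * suc j` have just been split.
uncarry-stage : ∀ {ℓ j xs} → suc j ≤ ℓ → Stage ℓ (suc j) xs → Stage ℓ j (uncarry (suc j) xs)
uncarry-stage {ℓ} {j} {xs} j<ℓ (stage bounded distinct odd-part) = stage
  (All.++⁺ (All.replicate⁺ _ (s≤s z≤n , ≤-trans j<ℓ (m≤m+n ℓ _)))
    (All.filter⁺ (¬? ∘ (2 * suc j ≡?_)) bounded))
  (λ p≤j → subst (_≤ 1)
    (sym (mult-uncarry-other (suc j) xs (<⇒≢ (s≤s p≤j)) (<⇒≢ (≤-trans (s≤s p≤j) (m≤m+n (suc j) _)))))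
    (distinct (m≤n⇒m≤1+n p≤j)))
  odd-part′
  where
  odd-part′ : ∀ {p} → j < p → mult (2 * p) (uncarry (suc j) xs) ≡ 0
  odd-part′ {p} j<p with suc j ≡? p
  ... | yes refl = mult-uncarry-double (suc j) xs
  ... | no  j≢p  =
    let j<p′ = ≤∧≢⇒< j<p j≢p
    in trans (mult-uncarry-other (suc j) xs (2*-≢ j<p′) (2*-≢-2* j<p′)) (odd-part j<p′)

carries-stage : ∀ {ℓ xs} j → j ≤ ℓ → Stage ℓ 0 xs → Stage ℓ j (carries j xs)
carries-stage zero    _   s = s
carries-stage (suc j) j<ℓ s = carry-stage j<ℓ (carries-stage j (<⇒≤ j<ℓ) s)

uncarries-stage : ∀ {ℓ xs} j → j ≤ ℓ → Stage ℓ j xs → Stage ℓ 0 (uncarries j xs)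
uncarries-stage zero    _   s = s
uncarries-stage (suc j) j<ℓ s = uncarries-stage j (<⇒≤ j<ℓ) (uncarry-stage j<ℓ s)

-- The last step is undone first. Its side condition, that `2 * suc j` is absent, is the `odd-part`
-- field of the stage reached after `j` steps.
uncarries-carries : ∀ {ℓ xs} j → j ≤ ℓ → Stage ℓ 0 xs → uncarries j (carries j xs) ≈ xs
uncarries-carries zero    _   s p = refl
uncarries-carries {xs = xs} (suc j) j<ℓ s p = trans
  (uncarries-cong j {uncarry (suc j) (carry (suc j) (carries j xs))} {carries j xs}
    (uncarry-carry (suc j) (carries j xs) (Stage.odd-part (carries-stage j (<⇒≤ j<ℓ) s) ≤-refl)) p)
  (uncarries-carries j (<⇒≤ j<ℓ) s p)

-- Here the side condition for cancelling the outermost step is the `distinct` field at `suc j`.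
carries-uncarries : ∀ {ℓ xs} j → j ≤ ℓ → Stage ℓ j xs → carries j (uncarries j xs) ≈ xs
carries-uncarries zero    _   s p = refl
carries-uncarries {xs = xs} (suc j) j<ℓ s p = trans
  (carry-cong (suc j) {carries j (uncarries (suc j) xs)} {uncarry (suc j) xs}
    (carries-uncarries j (<⇒≤ j<ℓ) (uncarry-stage j<ℓ s)) p)
  (carry-uncarry (suc j) xs (Stage.distinct s ≤-refl) p)

-- `Tail ℓ 0` describes the lists that follow `2 * ℓ ∸ 1` on the B side, `Tail ℓ ℓ` those that
-- follow `2 * ℓ` on the C side. Sortedness turns equality of multisets into equality of lists.
Tail : (ℓ j : ℕ) → List ℕ → Set
Tail ℓ j xs = Decreasing xs × Stage ℓ j xs

carried uncarried : ℕ → List ℕ → List ℕ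
carried   ℓ xs = sort (carries ℓ xs)
uncarried ℓ xs = sort (uncarries ℓ xs)

carried-tail : ∀ {ℓ xs} → Tail ℓ 0 xs → Tail ℓ ℓ (carried ℓ xs)
carried-tail {ℓ} {xs} (_ , s) =
  sort-decreasing _ , Stage-resp-↭ (↭-sym (sort-↭ _)) (carries-stage ℓ ≤-refl s)

uncarried-tail : ∀ {ℓ xs} → Tail ℓ ℓ xs → Tail ℓ 0 (uncarried ℓ xs)
uncarried-tail {ℓ} {xs} (_ , s) =
  sort-decreasing _ , Stage-resp-↭ (↭-sym (sort-↭ _)) (uncarries-stage ℓ ≤-refl s)

uncarried-carried : ∀ {ℓ xs} → Tail ℓ 0 xs → uncarried ℓ (carried ℓ xs) ≡ xs
uncarried-carried {ℓ} {xs} (xs↘ , s) = decreasing-unique (sort-decreasing _) xs↘ λ p →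
  trans (↭⇒≈ (sort-↭ (uncarries ℓ (carried ℓ xs))) p)
    (trans (uncarries-cong ℓ (↭⇒≈ (sort-↭ (carries ℓ xs))) p) (uncarries-carries ℓ ≤-refl s p))

carried-uncarried : ∀ {ℓ xs} → Tail ℓ ℓ xs → carried ℓ (uncarried ℓ xs) ≡ xs
carried-uncarried {ℓ} {xs} (xs↘ , s) = decreasing-unique (sort-decreasing _) xs↘ λ p →
  trans (↭⇒≈ (sort-↭ (carries ℓ (uncarried ℓ xs))) p)
    (trans (carries-cong ℓ (↭⇒≈ (sort-↭ (uncarries ℓ xs))) p) (carries-uncarries ℓ ≤-refl s p))

sum-carried : ∀ ℓ xs → sum (carried ℓ xs) ≡ sum xs
sum-carried ℓ xs = trans (sum-↭ (sort-↭ (carries ℓ xs))) (sum-carries ℓ xs)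

-- The correspondence

suc[2ℓ∸1] : ∀ {ℓ} → 1 ≤ ℓ → suc (2 * ℓ ∸ 1) ≡ 2 * ℓ
suc[2ℓ∸1] {suc _} _ = refl

-- If 2 divided this number as well as its successor `2 * ℓ`, it would divide 1.
odd[2ℓ∸1] : ∀ {ℓ} → 1 ≤ ℓ → Odd (2 * ℓ ∸ 1)
odd[2ℓ∸1] {ℓ} 1≤ℓ 2∣ with () ← ∣1⇒≡1 (∣m+n∣m⇒∣n
  (subst (2 ∣_) (trans (sym (suc[2ℓ∸1] 1≤ℓ)) (+-comm 1 _)) (m∣m*n ℓ)) 2∣)

odd-tail⁺ : ∀ {ℓ xs} → 1 ≤ ℓ → Decreasing xs → All Odd xs → All (_≤ 2 * ℓ ∸ 1) xs → Tail ℓ 0 xs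
odd-tail⁺ {ℓ} {xs} 1≤ℓ xs↘ odds xs≤ = xs↘ , stage
  (All.zipWith (λ (o , x≤) → n≢0⇒n>0 (λ { refl → o (2 ∣0) }) , ≤-trans x≤ (m∸n≤m _ 1)) (odds , xs≤))
  -- Only size 0 is to be checked, and 0, being even, does not occur.
  (λ { z≤n → ≤-trans (≤-reflexive (All≢⇒mult≡0 (All.map (λ { o refl → o (2 ∣0) }) odds))) z≤n })
  (λ {p} _ → All≢⇒mult≡0 (All.map (λ { o refl → o (m∣m*n p) }) odds))

-- A positive even part is the double of some positive size, which stage 0 forbids. The bound
-- `2 * ℓ` is itself even, so it is not attained and drops by one.
odd-tail⁻ : ∀ {ℓ xs} → 1 ≤ ℓ → Tail ℓ 0 xs → All Odd xs × All (_≤ 2 * ℓ ∸ 1) xs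
odd-tail⁻ {ℓ} {xs} 1≤ℓ (_ , stage bounded _ odd-part) = All.tabulate odd , All.tabulate x≤
  where
  odd : ∀ {x} → x ∈ xs → Odd x
  odd x∈ (divides zero    refl) with () ← proj₁ (All.lookup bounded x∈)
  odd x∈ (divides (suc q) refl) = contradiction
    (odd-part (s≤s z≤n))
    (>⇒≢ (∈⇒0<mult (subst (_∈ xs) (*-comm (suc q) 2) x∈)))
  x≤ : ∀ {x} → x ∈ xs → x ≤ 2 * ℓ ∸ 1
  x≤ {x} x∈ = s≤s⁻¹ (subst (x <_) (sym (suc[2ℓ∸1] 1≤ℓ))
    (≤∧≢⇒< (proj₂ (All.lookup bounded x∈)) λ { refl → odd x∈ (m∣m*n ℓ) }))

mixed-tail⁺ : ∀ {ℓ xs} → Decreasing xs → All (1 ≤_) xs → All (_≤ 2 * ℓ) xs →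
              Unique (partsUpTo ℓ xs) → Tail ℓ ℓ xs
mixed-tail⁺ {ℓ} {xs} xs↘ 1≤ ≤2ℓ u = xs↘ , stage
  (All.zip (1≤ , ≤2ℓ))
  (λ {p} p≤ℓ → subst (_≤ 1) (mult-filter (_≤? ℓ) p≤ℓ xs) (Unique⇒mult≤1 u p))
  -- Doubles of sizes beyond `ℓ` exceed the bound `2 * ℓ`.
  (λ ℓ<p → All≢⇒mult≡0 (All.map (λ { x≤ refl → <⇒≱ (*-monoʳ-< 2 ℓ<p) x≤ }) ≤2ℓ))

mixed-tail⁻ : ∀ {ℓ xs} → Tail ℓ ℓ xs → Unique (partsUpTo ℓ xs)
mixed-tail⁻ {ℓ} {xs} (_ , s) = mult≤1⇒Unique _ mult≤1
  where
  mult≤1 : ∀ p → mult p (partsUpTo ℓ xs) ≤ 1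
  mult≤1 p with p ≤? ℓ
  ... | yes p≤ℓ = subst (_≤ 1) (sym (mult-filter (_≤? ℓ) p≤ℓ xs)) (Stage.distinct s p≤ℓ)
  ... | no  p≰ℓ = ≤-trans (≤-reflexive (mult-filter-¬ (_≤? ℓ) p≰ℓ xs)) z≤n

-- The graph of the bijection, parametrised by the data `ℓ`, `E` and `O` that both partitions share.
-- The index `n` is the weight of the first partition; the second weighs one more.
data Match (Q : Pred ℕ 0ℓ) (k n : ℕ) : List ℕ → List ℕ × ℕ → Set where
  match : ∀ {ℓ E O} → 1 ≤ ℓ → Decreasing E → AdmissibleEvens k ℓ E → Q (length E) →
          Tail ℓ 0 O → sum E + ((2 * ℓ ∸ 1) + sum O) ≡ n →
          Match Q k n (E ++ (2 * ℓ ∸ 1) ∷ O) (E ++ 2 * ℓ ∷ carried ℓ O , ℓ)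

evens-above : ∀ k ℓ {E} → AdmissibleEvens k ℓ E → All (2 * ℓ <_) E
evens-above k ℓ (_ , _ , _ , ranges) =
  All.map (λ (lo , _) → <-≤-trans (m<m+n (2 * ℓ) (s≤s z≤n)) lo) ranges

-- `E` and `2 * ℓ` lie above `ℓ`, so the distinctness condition on a C partition concerns its tail
-- alone.
partsUpTo-skip : ∀ {ℓ E} S → 1 ≤ ℓ → All (2 * ℓ <_) E →
                 partsUpTo ℓ (E ++ 2 * ℓ ∷ S) ≡ partsUpTo ℓ S
partsUpTo-skip {ℓ} {E} S 1≤ℓ 2ℓ<E = begin
  partsUpTo ℓ (E ++ 2 * ℓ ∷ S)
    ≡⟨ filter-++ (_≤? ℓ) E (2 * ℓ ∷ S) ⟩
  partsUpTo ℓ E ++ partsUpTo ℓ (2 * ℓ ∷ S)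
    ≡⟨ cong₂ _++_
         (filter-none (_≤? ℓ) (All.map (λ 2ℓ<x → <⇒≱ (≤-<-trans (m≤m+n ℓ _) 2ℓ<x)) 2ℓ<E))
         (filter-reject (_≤? ℓ) (<⇒≱ (m<m+n ℓ (≤-trans 1≤ℓ (m≤m+n ℓ 0))))) ⟩
  partsUpTo ℓ S ∎
  where open ≡-Reasoning

module _ {Q : Pred ℕ 0ℓ} {k n : ℕ} where

  Match⇒InB : ∀ {π λℓ} → Match Q k n π λℓ → InB Q k n π
  Match⇒InB (match {ℓ} {E} {O} 1≤ℓ E↘ adm@(_ , _ , evens , ranges) q tail@(O↘ , s) Σ≡n) =
    (positive , AllPairs⇒Linked decreasing , trans (sum-++ E _) Σ≡n) ,
    (ℓ , 1≤ℓ , (odd[2ℓ∸1] 1≤ℓ , ∈-++⁺ʳ E (here refl) , largest) ,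
      subst (AdmissibleEvens k ℓ) (sym E≡) adm) ,
    subst (Q ∘ length) (sym E≡) q
    where
    odds : All Odd O
    odds = proj₁ (odd-tail⁻ 1≤ℓ tail)
    O≤ : All (_≤ 2 * ℓ ∸ 1) O
    O≤ = proj₂ (odd-tail⁻ 1≤ℓ tail)
    E≡ : evenParts (E ++ (2 * ℓ ∸ 1) ∷ O) ≡ E
    E≡ = filter-prefix even? evens (odd[2ℓ∸1] 1≤ℓ ∷ odds)
    decreasing : Decreasing (E ++ (2 * ℓ ∸ 1) ∷ O)
    decreasing = ++-decreasing E↘ (O≤ ∷ O↘) (evens-above k ℓ adm)
      (m∸n≤m _ 1 ∷ All.map (λ x≤ → ≤-trans x≤ (m∸n≤m _ 1)) O≤)
    positive : All (1 ≤_) (E ++ (2 * ℓ ∸ 1) ∷ O)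
    positive = All.++⁺ (All.map (≤-trans (s≤s z≤n)) (evens-above k ℓ adm))
      (≤-trans 1≤ℓ (ℓ≤2ℓ∸1 1≤ℓ) ∷ All.map proj₁ (Stage.bounded s))
    largest : All (λ p → Odd p → p ≤ 2 * ℓ ∸ 1) (E ++ (2 * ℓ ∸ 1) ∷ O)
    largest = All.++⁺ (All.map (λ e o → contradiction e o) evens)
      ((λ _ → ≤-refl) ∷ All.map (λ x≤ _ → x≤) O≤)

  Match⇒InC : ∀ {π λℓ} → Match Q k n π λℓ → InC Q k (n + 1) λℓ
  Match⇒InC (match {ℓ} {E} {O} 1≤ℓ E↘ adm q tail Σ≡n) =
    1≤ℓ ,
    (positive , AllPairs⇒Linked decreasing , Σ≡n+1) ,
    ∈-++⁺ʳ E (here refl) ,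
    subst Unique (sym (partsUpTo-skip S 1≤ℓ (evens-above k ℓ adm))) (mixed-tail⁻ tail′) ,
    subst (AdmissibleEvens k ℓ) (sym E≡) adm ,
    subst (Q ∘ length) (sym E≡) q
    where
    S : List ℕ
    S = carried ℓ O
    tail′ : Tail ℓ ℓ S
    tail′ = carried-tail tail
    S≤ : All (_≤ 2 * ℓ) S
    S≤ = All.map proj₂ (Stage.bounded (proj₂ tail′))
    E≡ : partsAbove (2 * ℓ) (E ++ 2 * ℓ ∷ S) ≡ E
    E≡ = filter-prefix (2 * ℓ <?_) (evens-above k ℓ adm) (All.map ≤⇒≯ (≤-refl ∷ S≤))
    decreasing : Decreasing (E ++ 2 * ℓ ∷ S)
    decreasing = ++-decreasing E↘ (S≤ ∷ proj₁ tail′) (evens-above k ℓ adm) (≤-refl ∷ S≤)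
    positive : All (1 ≤_) (E ++ 2 * ℓ ∷ S)
    positive = All.++⁺ (All.map (≤-trans (s≤s z≤n)) (evens-above k ℓ adm))
      (≤-trans 1≤ℓ (m≤m+n ℓ _) ∷ All.map proj₁ (Stage.bounded (proj₂ tail′)))
    Σ≡n+1 : sum (E ++ 2 * ℓ ∷ S) ≡ n + 1
    Σ≡n+1 = begin
      sum (E ++ 2 * ℓ ∷ S)                     ≡⟨ sum-++ E _ ⟩
      -- Carrying keeps the weight of the tail; the one extra unit comes from `2 * ℓ` being the
      -- successor of `2 * ℓ ∸ 1`.
      sum E + (2 * ℓ + sum S)                  ≡⟨ cong₂ (λ a b → sum E + (a + b)) (sym (suc[2ℓ∸1] 1≤ℓ)) (sum-carried ℓ O) ⟩
      sum E + (suc (2 * ℓ ∸ 1) + sum O)        ≡⟨ +-suc (sum E) _ ⟩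
      suc (sum E + ((2 * ℓ ∸ 1) + sum O))      ≡⟨ cong suc Σ≡n ⟩
      suc n                                    ≡⟨ +-comm 1 n ⟩
      n + 1                                    ∎
      where open ≡-Reasoning

  InB⇒Match : ∀ {π} → InB Q k n π → ∃ λ λℓ → Match Q k n π λℓ
  InB⇒Match {π} ((pos , π↘ₗ , Σ≡n) , (ℓ , 1≤ℓ , (odd , m∈π , largest) , adm) , q) =
    assemble (decreasing-with-max (AllPairs.filter⁺ odd? π↘) (∈-filter⁺ odd? m∈π odd) odds≤)
    where
    π↘ : Decreasing π
    π↘ = Linked⇒AllPairs (λ i≥j j≥k → ≤-trans j≥k i≥j) π↘ₗ
    odds≤ : All (_≤ 2 * ℓ ∸ 1) (filter odd? π)
    odds≤ = All.zipWith (λ (o , f) → f o) (All.all-filter odd? π , All.filter⁺ odd? largest)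
    cut : π ≡ evenParts π ++ filter odd? π
    -- Even parts lie above `2 * ℓ` and odd parts below it, so sorting by parity is sorting by size.
    cut = decreasing-cut even? (2 * ℓ) π↘
      (All.tabulate λ x∈π e → All.lookup (evens-above k ℓ adm) (∈-filter⁺ even? x∈π e))
      (All.map (λ f o → ≤-trans (f o) (m∸n≤m _ 1)) largest)
    assemble : (∃ λ O → filter odd? π ≡ (2 * ℓ ∸ 1) ∷ O) → ∃ λ λℓ → Match Q k n π λℓ
    assemble (O , eq) = (_ , _) , subst (λ π′ → Match Q k n π′ (evenParts π ++ 2 * ℓ ∷ carried ℓ O , ℓ)) (sym π≡)
      (match 1≤ℓ (AllPairs.filter⁺ even? π↘) adm q
        (odd-tail⁺ 1≤ℓ (AllPairs.tail odds↘) (All.tail odds) (AllPairs.head odds↘))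
        (trans (sym (sum-++ (evenParts π) _)) (trans (cong sum (sym π≡)) Σ≡n)))
      where
      odds↘ : Decreasing ((2 * ℓ ∸ 1) ∷ O)
      odds↘ = subst Decreasing eq (AllPairs.filter⁺ odd? π↘)
      odds : All Odd ((2 * ℓ ∸ 1) ∷ O)
      odds = subst (All Odd) eq (All.all-filter odd? π)
      π≡ : π ≡ evenParts π ++ (2 * ℓ ∸ 1) ∷ O
      π≡ = trans cut (cong (evenParts π ++_) eq)

  InC⇒Match : ∀ {λℓ} → InC Q k (n + 1) λℓ → ∃ λ π → Match Q k n π λℓ
  InC⇒Match {μ , ℓ} (1≤ℓ , (pos , μ↘ₗ , Σ≡n+1) , 2ℓ∈μ , u , adm , q) =
    assemble (decreasing-with-max (AllPairs.filter⁺ low? μ↘)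
      (∈-filter⁺ low? 2ℓ∈μ (<-irrefl refl)) (All.map ≮⇒≥ (All.all-filter low? μ)))
    where
    low? : Decidable (λ x → ¬ 2 * ℓ < x)
    low? = ¬? ∘ (2 * ℓ <?_)
    E : List ℕ
    E = partsAbove (2 * ℓ) μ
    μ↘ : Decreasing μ
    μ↘ = Linked⇒AllPairs (λ i≥j j≥k → ≤-trans j≥k i≥j) μ↘ₗ
    cut : μ ≡ E ++ filter low? μ
    cut = decreasing-cut (2 * ℓ <?_) (2 * ℓ) μ↘
      (All.tabulate λ _ → id) (All.tabulate λ _ → ≮⇒≥)
    assemble : (∃ λ S → filter low? μ ≡ 2 * ℓ ∷ S) → ∃ λ π → Match Q k n π (μ , ℓ)
    -- `match` produces the tail `carried ℓ (uncarried ℓ S)`, which is transported back to `S`.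
    assemble (S , eq) = _ , subst (λ μ′ → Match Q k n (E ++ (2 * ℓ ∸ 1) ∷ uncarried ℓ S) (μ′ , ℓ)) (sym (trans μ≡ S≡))
      (match 1≤ℓ (AllPairs.filter⁺ (2 * ℓ <?_) μ↘) adm q (uncarried-tail tail) Σ≡n)
      where
      open ≡-Reasoning
      μ≡ : μ ≡ E ++ 2 * ℓ ∷ S
      μ≡ = trans cut (cong (E ++_) eq)
      S↘ : Decreasing (2 * ℓ ∷ S)
      S↘ = subst Decreasing eq (AllPairs.filter⁺ low? μ↘)
      tail : Tail ℓ ℓ S
      tail = mixed-tail⁺ (AllPairs.tail S↘)
        (All.tail (subst (All (1 ≤_)) eq (All.filter⁺ low? pos)))
        (AllPairs.head S↘)
        (subst Unique (trans (cong (partsUpTo ℓ) μ≡) (partsUpTo-skip S 1≤ℓ (evens-above k ℓ adm))) u)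
      S≡ : E ++ 2 * ℓ ∷ S ≡ E ++ 2 * ℓ ∷ carried ℓ (uncarried ℓ S)
      S≡ = cong (λ S′ → E ++ 2 * ℓ ∷ S′) (sym (carried-uncarried tail))
      Σ≡n : sum E + ((2 * ℓ ∸ 1) + sum (uncarried ℓ S)) ≡ n
      Σ≡n = suc-injective (begin
        suc (sum E + ((2 * ℓ ∸ 1) + sum (uncarried ℓ S)))
          ≡⟨ +-suc (sum E) _ ⟨
        sum E + (suc (2 * ℓ ∸ 1) + sum (uncarried ℓ S))
          ≡⟨ cong₂ (λ a b → sum E + (a + b)) (suc[2ℓ∸1] 1≤ℓ) (sym (sum-carried ℓ (uncarried ℓ S))) ⟩
        sum E + (2 * ℓ + sum (carried ℓ (uncarried ℓ S)))
          ≡⟨ sum-++ E _ ⟨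
        sum (E ++ 2 * ℓ ∷ carried ℓ (uncarried ℓ S))
          ≡⟨ cong sum (trans μ≡ S≡) ⟨
        sum μ
          ≡⟨ Σ≡n+1 ⟩
        n + 1
          ≡⟨ +-comm n 1 ⟩
        suc n ∎)

  -- The B partition determines its data: `E` is its even parts, the next part gives `ℓ`, and the
  -- rest is `O`.
  Match-functional : ∀ {π λℓ λℓ′} → Match Q k n π λℓ → Match Q k n π λℓ′ → λℓ ≡ λℓ′
  -- Concatenations in a shared index would block unification, so the indices are separated and
  -- their equality is decomposed by hand.
  Match-functional m m′ = go m m′ refl
    where
    go : ∀ {π π′ λℓ λℓ′} → Match Q k n π λℓ → Match Q k n π′ λℓ′ → π ≡ π′ → λℓ ≡ λℓ′
    go (match {ℓ} {E} {O} 1≤ℓ _ (_ , _ , evens , _) _ tail _)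
       (match {ℓ′} {E′} {O′} 1≤ℓ′ _ (_ , _ , evens′ , _) _ tail′ _) eq
      with refl ← trans (sym (filter-prefix even? evens (odd[2ℓ∸1] 1≤ℓ ∷ proj₁ (odd-tail⁻ 1≤ℓ tail))))
                    (trans (cong evenParts eq)
                      (filter-prefix even? evens′ (odd[2ℓ∸1] 1≤ℓ′ ∷ proj₁ (odd-tail⁻ 1≤ℓ′ tail′))))
      with m≡m′ , refl ← ∷-injective (++-cancelˡ E _ _ eq)
      with refl ← *-cancelˡ-≡ ℓ ℓ′ 2
                    (trans (sym (suc[2ℓ∸1] 1≤ℓ)) (trans (cong suc m≡m′) (suc[2ℓ∸1] 1≤ℓ′)))
      = refl

  -- The pair on the C side contains `ℓ`; its parts above `2 * ℓ` are `E`, and uncarrying what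
  -- follows `2 * ℓ` recovers `O`.
  Match-injective : ∀ {π π′ λℓ} → Match Q k n π λℓ → Match Q k n π′ λℓ → π ≡ π′
  Match-injective m m′ = go m m′ refl
    where
    prefix : ∀ {ℓ E O} → AdmissibleEvens k ℓ E → Tail ℓ 0 O →
             partsAbove (2 * ℓ) (E ++ 2 * ℓ ∷ carried ℓ O) ≡ E
    prefix {ℓ} adm tail = filter-prefix (2 * ℓ <?_) (evens-above k ℓ adm)
      (<-irrefl refl ∷ All.map (≤⇒≯ ∘ proj₂) (Stage.bounded (proj₂ (carried-tail tail))))
    go : ∀ {π π′ λℓ λℓ′} → Match Q k n π λℓ → Match Q k n π′ λℓ′ → λℓ ≡ λℓ′ → π ≡ π′
    go (match {ℓ} {E} {O} _ _ adm _ tail _) (match {_} {E′} {O′} _ _ adm′ _ tail′ _) eq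
      with μ≡ , refl ← ,-injective eq
      with refl ← trans (sym (prefix adm tail))
                    (trans (cong (partsAbove (2 * ℓ)) μ≡) (prefix adm′ tail′))
      with _ , S≡ ← ∷-injective (++-cancelˡ E _ _ μ≡)
      = cong (λ O → E ++ (2 * ℓ ∸ 1) ∷ O)
          (trans (sym (uncarried-carried tail))
            (trans (cong (uncarried ℓ) S≡) (uncarried-carried tail′)))

  -- `Match` relates every element of either side to one of the other and is injective both ways,
  -- which gives the two opposite inequalities.
  card-B≡card-C : (b : Enumeration (InB Q k n)) (c : Enumeration (InC Q k (n + 1))) →
                  Enumeration.card b ≡ Enumeration.card c
  card-B≡card-C b c = ≤-antisym
    (card-≤-by-injective (Match Q k n) Match-injective b c
      λ ∈B → map₂ (λ m → Match⇒InC m , m) (InB⇒Match ∈B))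
    (card-≤-by-injective (λ λℓ π → Match Q k n π λℓ) Match-functional c b
      λ ∈C → map₂ (λ m → Match⇒InB m , m) (InC⇒Match ∈C))

theorem2 : (n k : ℕ) → 1 ≤ n → 1 ≤ k →
    (Bᵉ k n ≡ Cᵉ k (n + 1)) × (Bᵒ k n ≡ Cᵒ k (n + 1))
theorem2 n k _ _ =
  card-B≡card-C {Even} {k} {n} (enumB even? k n) (enumC even? k (n + 1)) ,
  card-B≡card-C {Odd} {k} {n} (enumB odd? k n) (enumC odd? k (n + 1))
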